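{- Let $p$ be an integer. For any non-negative integer $n$, $$\sum_{k=0}^{n}\genfrac{[}{]}{0pt}{}{n+1}{k+1}B_{k}^{(p)}=n!\,H_{n+1}^{(p)}.$$
   Context: $H_n^{(p)}=\sum_{k=1}^n 1/k^p$ are the generalized harmonic numbers. $\genfrac{[}{]}{0pt}{}{n}{k}$ are the (unsigned) Stirling numbers of the first kind, so that $(x+1)(x+2)\cdots(x+n)=\sum_{k=0}^{n}\genfrac{[}{]}{0pt}{}{n+1}{k+1}x^{k}$. The poly-Bernoulli numbers $B_k^{(p)}$ are defined by $\sum_{n=0}^{\infty}B_{n}^{(p)}\frac{t^{n}}{n!}=\frac{\mathrm{Li}_{p}(1-e^{ -t})}{1-e^{ -t}}$, where $\mathrm{Li}_p(t)=\sum_{n=1}^{\infty}t^n/n^p$ (as formal power series). -}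

module Defs where

open import Algebra.Bundles using (Semiring; CommutativeRing; RawSemiring)
import Algebra.Definitions.RawSemiring as RawSemiringDefs
import Algebra.Properties.Semiring.Sum as SemiringSum
open import Data.Fin.Base as Fin using (Fin; toℕ; fromℕ; inject₁)
open import Data.Fin.Properties using (toℕ-fromℕ; toℕ-inject₁; toℕ≤pred[n])
open import Data.Integer.Base using (ℤ; +_; -[1+_])
open import Data.Nat.Base as ℕ using (ℕ; zero; suc; _∸_; _!)
import Data.Nat.Properties as ℕ
open import Data.Rational.Base using (ℚ; 0ℚ; 1ℚ; _+_; _*_; _-_; -_; _/_; _÷_; 1/_; NonZero)
import Data.Rational.Base as ℚ
import Data.Rational.Properties as ℚ
open import Relation.Binary.PropositionalEquality

open SemiringSum (CommutativeRing.semiring ℚ.+-*-commutativeRing) public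

------------------------------------------------------------------------
-- Formal power series, as sequences of coefficients

module PowerSeries {c ℓ} (R : Semiring c ℓ) where
  private
    module R = Semiring R
    module Sum = SemiringSum R

  Series : Set c
  Series = ℕ → R.Carrier

  const : R.Carrier → Series
  const a zero    = a
  const a (suc n) = R.0#

  var : Series
  var 1 = R.1#
  var _ = R.0#

  rawSemiring : RawSemiring c ℓ
  rawSemiring = record
    { Carrier = Series
    ; _≈_     = λ f g → ∀ n → f n R.≈ g n
    ; _+_     = λ f g n → f n R.+ g n
    ; _*_     = λ f g n → Sum.sum {suc n} λ i → f (toℕ i) R.* g (n ∸ toℕ i)
    ; 0#      = const R.0#
    ; 1#      = const R.1#
    }

  open RawSemiring rawSemiring public
    using () renaming (_+_ to _⊕_; _*_ to _⊗_)
  open RawSemiringDefs rawSemiring public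
    using () renaming (_^_ to _^ˢ_; product to ∏)

  -- Correct only when g has zero constant term: then g ^ˢ m has no
  -- terms of degree below m, so truncating at m ≤ n loses nothing.
  infixr 9 _⟨_⟩
  _⟨_⟩ : Series → Series → Series
  (f ⟨ g ⟩) n = Sum.sum {suc n} λ m → f (toℕ m) R.* (g ^ˢ toℕ m) n

  tail : Series → Series
  tail f n = f (suc n)

------------------------------------------------------------------------
-- Stirling numbers of the first kind

private
  module ℕ[[x]] = PowerSeries ℕ.+-*-semiring

-- x (x + 1) ⋯ (x + (n - 1))
risingFactorial : ℕ → ℕ[[x]].Series
risingFactorial n = ℕ[[x]].∏ {n} λ i → ℕ[[x]].var ℕ[[x]].⊕ ℕ[[x]].const (toℕ i)

stirling₁ : ℕ → ℕ → ℕ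
stirling₁ n k = risingFactorial n k

------------------------------------------------------------------------
-- Generalized harmonic numbers

toℚ : ℕ → ℚ
toℚ n = + n / 1

-- 1 / k ^ p
recipPow : (k : ℕ) .{{_ : ℕ.NonZero k}} → ℤ → ℚ
recipPow k (+ m)    = (+ 1 / (k ℕ.^ m)) {{ℕ.m^n≢0 k m}}
recipPow k -[1+ m ] = toℚ (k ℕ.^ suc m)

harmonic : ℤ → ℕ → ℚ
harmonic p n = ∑[ i < n ] recipPow (suc (toℕ i)) p

------------------------------------------------------------------------
-- Poly-Bernoulli numbers

open PowerSeries (CommutativeRing.semiring ℚ.+-*-commutativeRing) public

-- Long division: f / g = c + t ((tail f - c tail g) / g) with c = f₀ / g₀.
divide : (f g : Series) .{{_ : NonZero (g 0)}} → Series
divide f g zero    = f 0 ÷ g 0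
divide f g (suc n) = divide (λ m → tail f m - (f 0 ÷ g 0) * tail g m) g n

1/_! : ℕ → ℚ
1/ n ! = (+ 1 / (n !)) {{n ℕ.!≢0}}

-- exp (- t)
exp⁻ : Series
exp⁻ n = (- 1ℚ) ^ n * 1/ n !
  where open RawSemiringDefs ℚ.+-*-rawSemiring using (_^_)

1-exp⁻ : Series
1-exp⁻ n = const 1ℚ n - exp⁻ n

polylog : ℤ → Series
polylog p zero    = 0ℚ
polylog p (suc n) = recipPow (suc n) p

-- Li_p(1 - e^(-t)) / (1 - e^(-t)).  Both series have zero constant term,
-- so a factor t is cancelled before dividing; see polyBernoulliGF-correct.
polyBernoulliGF : ℤ → Series
polyBernoulliGF p = divide (tail (polylog p ⟨ 1-exp⁻ ⟩)) (tail 1-exp⁻)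

polyBernoulli : ℤ → ℕ → ℚ
polyBernoulli p n = toℚ (n !) * polyBernoulliGF p n

------------------------------------------------------------------------
-- The defining equation of the generating function

open ≡-Reasoning

÷-*-cancel : ∀ x y .{{_ : NonZero y}} → (x ÷ y) * y ≡ x
÷-*-cancel x y = begin
  x * 1/ y * y    ≡⟨ ℚ.*-assoc x (1/ y) y ⟩
  x * (1/ y * y)  ≡⟨ cong (x *_) (ℚ.*-inverseˡ y) ⟩
  x * 1ℚ          ≡⟨ ℚ.*-identityʳ x ⟩
  x               ∎

divide-⊗ : ∀ f g .{{_ : NonZero (g 0)}} → divide f g ⊗ g ≗ f
divide-⊗ f g zero    = trans (ℚ.+-identityʳ _) (÷-*-cancel (f 0) (g 0))
divide-⊗ f g (suc n) = begin
  a + (divide (λ m → tail f m - (f 0 ÷ g 0) * tail g m) g ⊗ g) n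
    ≡⟨ cong (λ x → a + x) (divide-⊗ (λ m → tail f m - (f 0 ÷ g 0) * tail g m) g n) ⟩
  a + (b - a)    ≡⟨ ℚ.+-comm a (b - a) ⟩
  b - a + a      ≡⟨ ℚ.+-assoc b (- a) a ⟩
  b + (- a + a)  ≡⟨ cong (λ x → b + x) (ℚ.+-inverseˡ a) ⟩
  b + 0ℚ         ≡⟨ ℚ.+-identityʳ b ⟩
  b              ∎
  where
  a = (f 0 ÷ g 0) * g (suc n)
  b = f (suc n)

⊗-tail : ∀ f g → g 0 ≡ 0ℚ → ∀ n → (f ⊗ g) (suc n) ≡ (f ⊗ tail g) n
⊗-tail f g g₀≡0 n = begin
  (f ⊗ g) (suc n)                         ≡⟨ sum-init-last t ⟩
  sum (λ i → t (inject₁ i)) + t (fromℕ (suc n))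
    ≡⟨ cong₂ _+_ (sum-cong-≗ init≡) last≡0 ⟩
  (f ⊗ tail g) n + 0ℚ                     ≡⟨ ℚ.+-identityʳ _ ⟩
  (f ⊗ tail g) n                          ∎
  where
  t : Fin (suc (suc n)) → ℚ
  t i = f (toℕ i) * g (suc n ∸ toℕ i)
  init≡ : ∀ i → t (inject₁ i) ≡ f (toℕ i) * g (suc (n ∸ toℕ i))
  init≡ i = begin
    t (inject₁ i)                    ≡⟨ cong (λ j → f j * g (suc n ∸ j)) (toℕ-inject₁ i) ⟩
    f (toℕ i) * g (suc n ∸ toℕ i)    ≡⟨ cong (λ j → f (toℕ i) * g j) (ℕ.+-∸-assoc 1 (toℕ≤pred[n] i)) ⟩
    f (toℕ i) * g (suc (n ∸ toℕ i))  ∎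
  last≡0 : t (fromℕ (suc n)) ≡ 0ℚ
  last≡0 = begin
    t (fromℕ (suc n))              ≡⟨ cong (λ j → f j * g (suc n ∸ j)) (toℕ-fromℕ (suc n)) ⟩
    f (suc n) * g (suc n ∸ suc n)  ≡⟨ cong (λ j → f (suc n) * g j) (ℕ.n∸n≡0 n) ⟩
    f (suc n) * g 0                ≡⟨ cong (f (suc n) *_) g₀≡0 ⟩
    f (suc n) * 0ℚ                 ≡⟨ ℚ.*-zeroʳ (f (suc n)) ⟩
    0ℚ                             ∎

polyBernoulliGF-correct : ∀ p → polyBernoulliGF p ⊗ 1-exp⁻ ≗ polylog p ⟨ 1-exp⁻ ⟩
polyBernoulliGF-correct p zero = begin
  polyBernoulliGF p 0 * 0ℚ + 0ℚ  ≡⟨ cong (_+ 0ℚ) (ℚ.*-zeroʳ (polyBernoulliGF p 0)) ⟩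
  0ℚ                             ∎
polyBernoulliGF-correct p (suc n) =
  trans (⊗-tail (polyBernoulliGF p) 1-exp⁻ refl n)
        (divide-⊗ (tail (polylog p ⟨ 1-exp⁻ ⟩)) (tail 1-exp⁻) n)

{-# OPTIONS --safe #-}

-- Put u = 1 - e^(-t), so that the generating function of B_k^(p) is
-- ∑ₘ u^m / (m + 1)^p, and let Lₙ f = ∑ₖ [n+1, k+1] k! fₖ.  The Stirling
-- recurrence gives Lₙ₊₁ f = Lₙ f′ + (n + 1) Lₙ f, and u′ = 1 - u, whence
-- Lₙ (u^m) = n! for all m ≤ n by induction on n.  Since u^m has no terms of
-- degree below m, only the powers with m ≤ n contribute to the sum.

module Submission where

import Algebra.Definitions.RawSemiring as RawSemiringDefs
import Algebra.Properties.Semiring.Sum as SemiringSum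
open import Defs
open import Data.Fin.Base as Fin using (Fin; toℕ; opposite)
open import Data.Fin.Permutation using (reverse)
open import Data.Fin.Properties
  using (toℕ-fromℕ; toℕ-inject₁; toℕ≤pred[n]; opposite-prop)
open import Data.Integer.Base as ℤ using (ℤ)
import Data.Integer.Properties as ℤ
open import Data.Nat.Base as ℕ using (ℕ; zero; suc; _!; _∸_; _≤_; _<_; z≤n; s≤s)
import Data.Nat.Properties as ℕ
open import Data.Nat.Solver using (module +-*-Solver)
open import Data.Rational.Base
  using (ℚ; 0ℚ; 1ℚ; _+_; _*_; _-_; -_; _/_; _÷_; NonZero; fromℚᵘ)
import Data.Rational.Base as ℚ
import Data.Rational.Properties as ℚ
import Data.Rational.Solver as ℚ-Solver
open import Data.Rational.Unnormalised.Base as ℚᵘ using (mkℚᵘ; *≡*)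
import Data.Rational.Unnormalised.Properties as ℚᵘ
open import Data.Sum.Base using (_⊎_; inj₁; inj₂)
open import Function.Base using (_∘_)
open import Relation.Binary.PropositionalEquality
  using (_≡_; refl; sym; trans; cong; cong₂; _≗_; module ≡-Reasoning)

open ≡-Reasoning

private
  module ℕ[[x]] = PowerSeries ℕ.+-*-semiring
  module ℚ^ = RawSemiringDefs ℚ.+-*-rawSemiring
  module ∑ℕ = SemiringSum ℕ.+-*-semiring

-- The embedding of ℕ into ℚ

-- Sums in `ℚ` are normalised, so the equation is transported from `ℚᵘ`, where `toℚᵘ` is additive up
-- to `≃` and `fromℚᵘ` identifies equivalent fractions.
fromℚᵘ-homo-+ : ∀ p q → fromℚᵘ (p ℚᵘ.+ q) ≡ fromℚᵘ p + fromℚᵘ q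
fromℚᵘ-homo-+ p q = sym (trans (sym (ℚ.fromℚᵘ-toℚᵘ _)) (ℚ.fromℚᵘ-cong
  (ℚᵘ.≃-trans (ℚ.toℚᵘ-homo-+ (fromℚᵘ p) (fromℚᵘ q))
              (ℚᵘ.+-cong (ℚ.toℚᵘ-fromℚᵘ p) (ℚ.toℚᵘ-fromℚᵘ q)))))

fromℚᵘ-homo-* : ∀ p q → fromℚᵘ (p ℚᵘ.* q) ≡ fromℚᵘ p * fromℚᵘ q
fromℚᵘ-homo-* p q = sym (trans (sym (ℚ.fromℚᵘ-toℚᵘ _)) (ℚ.fromℚᵘ-cong
  (ℚᵘ.≃-trans (ℚ.toℚᵘ-homo-* (fromℚᵘ p) (fromℚᵘ q))
              (ℚᵘ.*-cong (ℚ.toℚᵘ-fromℚᵘ p) (ℚ.toℚᵘ-fromℚᵘ q)))))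

toℚ-homo-+ : ∀ m n → toℚ (m ℕ.+ n) ≡ toℚ m + toℚ n
toℚ-homo-+ m n = trans
  (cong (_/ 1) (sym (cong₂ ℤ._+_ (ℤ.*-identityʳ (ℤ.+ m)) (ℤ.*-identityʳ (ℤ.+ n)))))
  (fromℚᵘ-homo-+ (mkℚᵘ (ℤ.+ m) 0) (mkℚᵘ (ℤ.+ n) 0))

toℚ-homo-* : ∀ m n → toℚ (m ℕ.* n) ≡ toℚ m * toℚ n
toℚ-homo-* m n = trans
  (cong (_/ 1) (ℤ.pos-* m n))
  (fromℚᵘ-homo-* (mkℚᵘ (ℤ.+ m) 0) (mkℚᵘ (ℤ.+ n) 0))

toℚ-*-inverse : ∀ k .{{_ : ℕ.NonZero k}} → toℚ k * (ℤ.+ 1 / k) ≡ 1ℚ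
toℚ-*-inverse (suc k) = trans
  (sym (fromℚᵘ-homo-* (mkℚᵘ (ℤ.+ suc k) 0) (mkℚᵘ (ℤ.+ 1) k)))
  (ℚ.fromℚᵘ-cong {x = mkℚᵘ (ℤ.+ suc k) 0 ℚᵘ.* mkℚᵘ (ℤ.+ 1) k} {y = ℚᵘ.1ℚᵘ} (*≡* (cong ℤ.+_
    (solve 1 (λ k → (con 1 :+ k) :* con 1 :* con 1
                      := con 1 :* (con 1 :* (con 1 :+ k))) refl k))))
  where open +-*-Solver

toℚ-suc-1/! : ∀ n → toℚ (suc n) * 1/ suc n ! ≡ 1/ n !
toℚ-suc-1/! n = begin
  s * 1/ suc n !                        ≡⟨ ℚ.*-identityˡ _ ⟨
  -- The two reciprocals are related only through their factorials, so 1 = n! · (1/n!) is inserted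
  -- and the factors regrouped around (n+1)!.
  1ℚ * (s * 1/ suc n !)                 ≡⟨ cong (_* (s * 1/ suc n !)) (toℚ-*-inverse (n !) {{n ℕ.!≢0}}) ⟨
  f * 1/ n ! * (s * 1/ suc n !)
    ≡⟨ solve 4 (λ f g s h → f :* g :* (s :* h) := s :* f :* h :* g) refl f (1/ n !) s (1/ suc n !) ⟩
  s * f * 1/ suc n ! * 1/ n !           ≡⟨ cong (λ x → x * 1/ suc n ! * 1/ n !) (toℚ-homo-* (suc n) (n !)) ⟨
  toℚ (suc n !) * 1/ suc n ! * 1/ n !   ≡⟨ cong (_* 1/ n !) (toℚ-*-inverse (suc n !) {{suc n ℕ.!≢0}}) ⟩
  1ℚ * 1/ n !                           ≡⟨ ℚ.*-identityˡ _ ⟩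
  1/ n !                                ∎
  where
  open ℚ-Solver.+-*-Solver
  s = toℚ (suc n)
  f = toℚ (n !)

-- Finite sums

sum-last : ∀ (g : ℕ → ℚ) n → ∑[ i ≤ n ] g (toℕ i) ≡ ∑[ i < n ] g (toℕ i) + g n
sum-last g n = trans (sum-init-last {n} (g ∘ toℕ))
  (cong₂ _+_ (sum-cong-≗ {n} (cong g ∘ toℕ-inject₁)) (cong g (toℕ-fromℕ n)))

sum-zero : ∀ {n} (t : Fin n → ℚ) → (∀ i → t i ≡ 0ℚ) → sum t ≡ 0ℚ
sum-zero {n} t t≡0 = trans (sum-cong-≗ t≡0) (sum-replicate-zero n)

-- Serves to bring sums truncated at different bounds to a common range.
sum-extend : ∀ (g : ℕ → ℚ) {m n} → m ≤ n → (∀ i → m ≤ i → g i ≡ 0ℚ) →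
             ∑[ i < m ] g (toℕ i) ≡ ∑[ i < n ] g (toℕ i)
sum-extend g {m} m≤n g≡0 = go (ℕ.≤⇒≤′ m≤n)
  where
  go : ∀ {n} → m ℕ.≤′ n → ∑[ i < m ] g (toℕ i) ≡ ∑[ i < n ] g (toℕ i)
  go (ℕ.≤′-reflexive refl) = refl
  go {suc n} (ℕ.≤′-step m≤′n) = begin
    ∑[ i < m ] g (toℕ i)        ≡⟨ go m≤′n ⟩
    ∑[ i < n ] g (toℕ i)        ≡⟨ ℚ.+-identityʳ _ ⟨
    ∑[ i < n ] g (toℕ i) + 0ℚ   ≡⟨ cong ((∑[ i < n ] g (toℕ i)) +_) (g≡0 n (ℕ.≤′⇒≤ m≤′n)) ⟨
    ∑[ i < n ] g (toℕ i) + g n  ≡⟨ sum-last g n ⟨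
    ∑[ i ≤ n ] g (toℕ i)        ∎

-- Stirling numbers

infixr 7 x+_·_

-- Multiplication by the linear polynomial x + c, written on coefficients to avoid convolution sums.
x+_·_ : ℕ → ℕ[[x]].Series → ℕ[[x]].Series
(x+ c · f) zero    = c ℕ.* f 0
(x+ c · f) (suc k) = f k ℕ.+ c ℕ.* f (suc k)

x+-⊗ : ∀ c f → (ℕ[[x]].var ℕ[[x]].⊕ ℕ[[x]].const c) ℕ[[x]].⊗ f ≗ x+ c · f
x+-⊗ c f zero    = ℕ.+-identityʳ _
x+-⊗ c f (suc k) = begin
  c ℕ.* f (suc k) ℕ.+ (1 ℕ.* f k ℕ.+ _)
    -- The remaining k summands carry coefficients of x + c of degree at least 2, which compute to
    -- zero.
    ≡⟨ cong (λ s → c ℕ.* f (suc k) ℕ.+ (1 ℕ.* f k ℕ.+ s)) (∑ℕ.sum-replicate-zero k) ⟩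
  c ℕ.* f (suc k) ℕ.+ (1 ℕ.* f k ℕ.+ 0)
    ≡⟨ solve 2 (λ a b → a :+ (con 1 :* b :+ con 0) := b :+ a) refl (c ℕ.* f (suc k)) (f k) ⟩
  f k ℕ.+ c ℕ.* f (suc k)
    ∎
  where open +-*-Solver

x+-cong : ∀ c {f g} → f ≗ g → x+ c · f ≗ x+ c · g
x+-cong c f≗g zero    = cong (c ℕ.*_) (f≗g 0)
x+-cong c f≗g (suc k) = cong₂ (λ a b → a ℕ.+ c ℕ.* b) (f≗g k) (f≗g (suc k))

x+-comm : ∀ c d f → x+ c · x+ d · f ≗ x+ d · x+ c · f
x+-comm c d f zero = solve 3 (λ c d a → c :* (d :* a) := d :* (c :* a)) refl c d (f 0)
  where open +-*-Solver
x+-comm c d f (suc zero) =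
  solve 4 (λ c d a b → d :* a :+ c :* (a :+ d :* b) := c :* a :+ d :* (a :+ c :* b))
    refl c d (f 0) (f 1)
  where open +-*-Solver
x+-comm c d f (suc (suc k)) =
  solve 5 (λ c d a b e → (a :+ d :* b) :+ c :* (b :+ d :* e)
                      := (a :+ c :* b) :+ d :* (b :+ c :* e))
    refl c d (f k) (f (suc k)) (f (suc (suc k)))
  where open +-*-Solver

-- `∏` unfolds at its first factor, while the Stirling recurrence needs the last one; commuting
-- linear factors bridges the gap. The constants `c` are arbitrary because the induction passes to
-- `c ∘ suc`.
∏-x+-last : ∀ (c : ℕ → ℕ) n →
  ℕ[[x]].∏ {suc n} (λ i → ℕ[[x]].var ℕ[[x]].⊕ ℕ[[x]].const (c (toℕ i)))
    ≗ x+ c n · ℕ[[x]].∏ {n} (λ i → ℕ[[x]].var ℕ[[x]].⊕ ℕ[[x]].const (c (toℕ i)))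
∏-x+-last c zero    k = x+-⊗ (c 0) _ k
∏-x+-last c (suc n) k = begin
  _                              ≡⟨ x+-⊗ (c 0) _ k ⟩
  (x+ c 0 · _) k                 ≡⟨ x+-cong (c 0) (∏-x+-last (c ∘ suc) n) k ⟩
  (x+ c 0 · x+ c (suc n) · _) k  ≡⟨ x+-comm (c 0) (c (suc n)) _ k ⟩
  (x+ c (suc n) · x+ c 0 · _) k  ≡⟨ x+-cong (c (suc n)) (x+-⊗ (c 0) _) k ⟨
  _                              ∎

stirling₁-suc-suc : ∀ n k →
  stirling₁ (suc n) (suc k) ≡ stirling₁ n k ℕ.+ n ℕ.* stirling₁ n (suc k)
stirling₁-suc-suc n k = ∏-x+-last (λ i → i) n (suc k)

stirling₁-< : ∀ {n k} → n < k → stirling₁ n k ≡ 0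
stirling₁-< {zero}  {suc k} _         = refl
stirling₁-< {suc n} {suc k} (s≤s n<k) = begin
  stirling₁ (suc n) (suc k)                   ≡⟨ stirling₁-suc-suc n k ⟩
  stirling₁ n k ℕ.+ n ℕ.* stirling₁ n (suc k)
    ≡⟨ cong₂ (λ a b → a ℕ.+ n ℕ.* b) (stirling₁-< n<k) (stirling₁-< (ℕ.m<n⇒m<1+n n<k)) ⟩
  n ℕ.* 0                                     ≡⟨ ℕ.*-zeroʳ n ⟩
  0                                           ∎

-- Power series over ℚ

⊗-congʳ : ∀ f {g h} → g ≗ h → f ⊗ g ≗ f ⊗ h
⊗-congʳ f g≗h n = sum-cong-≗ {suc n} λ i → cong (f (toℕ i) *_) (g≗h (n ∸ toℕ i))

⊗-comm : ∀ f g → f ⊗ g ≗ g ⊗ f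
⊗-comm f g n = begin
  (f ⊗ g) n
    ≡⟨ ∑-permute (λ i → f (toℕ i) * g (n ∸ toℕ i)) (reverse {suc n}) ⟩
  ∑[ i ≤ n ] (f (toℕ (opposite i)) * g (n ∸ toℕ (opposite i)))
    ≡⟨ sum-cong-≗ {suc n} swap ⟩
  (g ⊗ f) n
    ∎
  where
  swap : ∀ i → f (toℕ (opposite i)) * g (n ∸ toℕ (opposite i)) ≡ g (toℕ i) * f (n ∸ toℕ i)
  swap i = begin
    f (toℕ (opposite i)) * g (n ∸ toℕ (opposite i))
      ≡⟨ cong (λ j → f j * g (n ∸ j)) (opposite-prop i) ⟩
    f (n ∸ toℕ i) * g (n ∸ (n ∸ toℕ i))
      ≡⟨ cong (λ j → f (n ∸ toℕ i) * g j) (ℕ.m∸[m∸n]≡n (toℕ≤pred[n] i)) ⟩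
    f (n ∸ toℕ i) * g (toℕ i)
      ≡⟨ ℚ.*-comm (f (n ∸ toℕ i)) (g (toℕ i)) ⟩
    g (toℕ i) * f (n ∸ toℕ i)
      ∎

⊗-identityˡ : ∀ f → const 1ℚ ⊗ f ≗ f
⊗-identityˡ f n = begin
  1ℚ * f n + ∑[ i < n ] (0ℚ * f (n ∸ suc (toℕ i)))
    ≡⟨ cong₂ _+_ (ℚ.*-identityˡ (f n)) (sum-zero {n} _ λ i → ℚ.*-zeroˡ (f (n ∸ suc (toℕ i)))) ⟩
  f n + 0ℚ  ≡⟨ ℚ.+-identityʳ (f n) ⟩
  f n       ∎

⊗-distribˡ-- : ∀ f g h n → (f ⊗ (λ k → g k - h k)) n ≡ (f ⊗ g) n - (f ⊗ h) n
⊗-distribˡ-- f g h n = begin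
  (f ⊗ (λ k → g k - h k)) n
    -- The difference is recast as a sum with scalar -1, so that additivity and scalar linearity of
    -- finite sums apply.
    ≡⟨ sum-cong-≗ {suc n} (λ i → solve 3 (λ a b c → a :* (b :- c) := a :* b :+ (:- con 1ℚ) :* (a :* c)) refl
         (f (toℕ i)) (g (n ∸ toℕ i)) (h (n ∸ toℕ i))) ⟩
  ∑[ i ≤ n ] (f (toℕ i) * g (n ∸ toℕ i) + - 1ℚ * (f (toℕ i) * h (n ∸ toℕ i)))
    ≡⟨ ∑-distrib-+ {suc n} (λ i → f (toℕ i) * g (n ∸ toℕ i)) (λ i → - 1ℚ * (f (toℕ i) * h (n ∸ toℕ i))) ⟩
  (f ⊗ g) n + ∑[ i ≤ n ] (- 1ℚ * (f (toℕ i) * h (n ∸ toℕ i)))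
    ≡⟨ cong ((f ⊗ g) n +_) (*-distribˡ-sum {suc n} (- 1ℚ) (λ i → f (toℕ i) * h (n ∸ toℕ i))) ⟨
  (f ⊗ g) n + - 1ℚ * (f ⊗ h) n
    ≡⟨ solve 2 (λ a b → a :+ (:- con 1ℚ) :* b := a :- b) refl ((f ⊗ g) n) ((f ⊗ h) n) ⟩
  (f ⊗ g) n - (f ⊗ h) n
    ∎
  where open ℚ-Solver.+-*-Solver

⊗-*-scalar : ∀ a f g n → (f ⊗ (λ k → a * g k)) n ≡ a * (f ⊗ g) n
⊗-*-scalar a f g n = trans
  (sum-cong-≗ {suc n} λ i → solve 3 (λ a x y → x :* (a :* y) := a :* (x :* y)) refl
     a (f (toℕ i)) (g (n ∸ toℕ i)))
  (sym (*-distribˡ-sum {suc n} a λ i → f (toℕ i) * g (n ∸ toℕ i)))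
  where open ℚ-Solver.+-*-Solver

-- t d/dt, for which the Leibniz rule involves no index shift.
θ : Series → Series
θ f n = toℚ n * f n

-- The usual formal derivative: `θ f` has zero constant term, so `tail` removes exactly the extra
-- factor t.
deriv : Series → Series
deriv f = tail (θ f)

-- In the i-th term of the convolution n splits as i + (n - i), one part for each factor.
θ-⊗ : ∀ f g n → θ (f ⊗ g) n ≡ (θ f ⊗ g) n + (f ⊗ θ g) n
θ-⊗ f g n = begin
  toℚ n * (f ⊗ g) n
    ≡⟨ *-distribˡ-sum {suc n} (toℚ n) (λ i → f (toℕ i) * g (n ∸ toℕ i)) ⟩
  ∑[ i ≤ n ] (toℚ n * (f (toℕ i) * g (n ∸ toℕ i)))
    ≡⟨ sum-cong-≗ {suc n} split ⟩
  ∑[ i ≤ n ] (θ f (toℕ i) * g (n ∸ toℕ i) + f (toℕ i) * θ g (n ∸ toℕ i))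
    ≡⟨ ∑-distrib-+ {suc n} (λ i → θ f (toℕ i) * g (n ∸ toℕ i)) (λ i → f (toℕ i) * θ g (n ∸ toℕ i)) ⟩
  (θ f ⊗ g) n + (f ⊗ θ g) n
    ∎
  where
  split : ∀ (i : Fin (suc n)) → toℚ n * (f (toℕ i) * g (n ∸ toℕ i))
            ≡ θ f (toℕ i) * g (n ∸ toℕ i) + f (toℕ i) * θ g (n ∸ toℕ i)
  split i = begin
    toℚ n * (f j * g (n ∸ j))
      ≡⟨ cong (λ m → toℚ m * (f j * g (n ∸ j))) (ℕ.m+[n∸m]≡n (toℕ≤pred[n] i)) ⟨
    toℚ (j ℕ.+ (n ∸ j)) * (f j * g (n ∸ j))
      ≡⟨ cong (_* (f j * g (n ∸ j))) (toℚ-homo-+ j (n ∸ j)) ⟩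
    (toℚ j + toℚ (n ∸ j)) * (f j * g (n ∸ j))
      ≡⟨ solve 4 (λ a b x y → (a :+ b) :* (x :* y) := a :* x :* y :+ x :* (b :* y)) refl
           (toℚ j) (toℚ (n ∸ j)) (f j) (g (n ∸ j)) ⟩
    θ f j * g (n ∸ j) + f j * θ g (n ∸ j)
      ∎
    where
    open ℚ-Solver.+-*-Solver
    j = toℕ i

-- Cancels t in the Leibniz rule for `θ`. The vanishing constant terms of `θ f` and `θ g` remove the
-- first summand of one convolution and the last summand of the other.
deriv-⊗ : ∀ f g n → deriv (f ⊗ g) n ≡ (deriv f ⊗ g) n + (f ⊗ deriv g) n
deriv-⊗ f g n = begin
  deriv (f ⊗ g) n                           ≡⟨ θ-⊗ f g (suc n) ⟩
  (θ f ⊗ g) (suc n) + (f ⊗ θ g) (suc n)     ≡⟨ cong₂ _+_ head≡0 (⊗-tail f (θ g) (ℚ.*-zeroˡ (g 0)) n) ⟩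
  (deriv f ⊗ g) n + (f ⊗ deriv g) n         ∎
  where
  head≡0 : (θ f ⊗ g) (suc n) ≡ (deriv f ⊗ g) n
  head≡0 = begin
    0ℚ * f 0 * g (suc n) + (deriv f ⊗ g) n
      ≡⟨ solve 3 (λ a b c → con 0ℚ :* a :* b :+ c := c) refl (f 0) (g (suc n)) ((deriv f ⊗ g) n) ⟩
    (deriv f ⊗ g) n
      ∎
    where open ℚ-Solver.+-*-Solver

deriv-const : ∀ a n → deriv (const a) n ≡ 0ℚ
deriv-const a n = ℚ.*-zeroʳ (toℚ (suc n))

-- Powers of, and composition with, series without constant term.

-- With g = t · `tail g`, coefficient n+1 of g^(m+1) only involves coefficients of g^m of degree at
-- most n < m, which vanish by induction.
^ˢ-< : ∀ {g} → g 0 ≡ 0ℚ → ∀ {n m} → n < m → (g ^ˢ m) n ≡ 0ℚ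
^ˢ-< {g} g₀≡0 {zero} {suc m} _ = begin
  g 0 * (g ^ˢ m) 0 + 0ℚ  ≡⟨ ℚ.+-identityʳ _ ⟩
  g 0 * (g ^ˢ m) 0       ≡⟨ cong (_* (g ^ˢ m) 0) g₀≡0 ⟩
  0ℚ * (g ^ˢ m) 0        ≡⟨ ℚ.*-zeroˡ ((g ^ˢ m) 0) ⟩
  0ℚ                     ∎
^ˢ-< {g} g₀≡0 {suc n} {suc m} (s≤s n<m) = begin
  (g ⊗ (g ^ˢ m)) (suc n)  ≡⟨ ⊗-comm g (g ^ˢ m) (suc n) ⟩
  ((g ^ˢ m) ⊗ g) (suc n)  ≡⟨ ⊗-tail (g ^ˢ m) g g₀≡0 n ⟩
  ((g ^ˢ m) ⊗ tail g) n   ≡⟨ sum-zero {suc n} _ term≡0 ⟩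
  0ℚ                      ∎
  where
  term≡0 : ∀ (i : Fin (suc n)) → (g ^ˢ m) (toℕ i) * tail g (n ∸ toℕ i) ≡ 0ℚ
  term≡0 i = trans
    (cong (_* tail g (n ∸ toℕ i)) (^ˢ-< {g} g₀≡0 (ℕ.≤-<-trans (toℕ≤pred[n] i) n<m)))
    (ℚ.*-zeroˡ (tail g (n ∸ toℕ i)))

-- The truncation in `_⟨_⟩` depends on the degree k; a bound common to all k ≤ n allows double sums
-- to be interchanged.
⟨⟩-truncate : ∀ f {g} → g 0 ≡ 0ℚ → ∀ {k n} → k ≤ n →
              (f ⟨ g ⟩) k ≡ ∑[ m ≤ n ] (f (toℕ m) * (g ^ˢ toℕ m) k)
⟨⟩-truncate f {g} g₀≡0 {k} k≤n = sum-extend (λ m → f m * (g ^ˢ m) k) (s≤s k≤n)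
  λ m k<m → trans (cong (f m *_) (^ˢ-< {g} g₀≡0 k<m)) (ℚ.*-zeroʳ (f m))

-- This is f(g) - f(0) = (tail f)(g) · g with a factor t cancelled on both sides.
tail-⟨⟩ : ∀ f {g} → g 0 ≡ 0ℚ → (tail f ⟨ g ⟩) ⊗ tail g ≗ tail (f ⟨ g ⟩)
tail-⟨⟩ f {g} g₀≡0 n = begin
  ∑[ i ≤ n ] ((tail f ⟨ g ⟩) (toℕ i) * tail g (n ∸ toℕ i))
    ≡⟨ sum-cong-≗ {suc n} expand ⟩
  ∑[ i ≤ n ] ∑[ m ≤ n ] (tail f (toℕ m) * ((g ^ˢ toℕ m) (toℕ i) * tail g (n ∸ toℕ i)))
    ≡⟨ ∑-comm {suc n} {suc n} (λ i m → tail f (toℕ m) * ((g ^ˢ toℕ m) (toℕ i) * tail g (n ∸ toℕ i))) ⟩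
  ∑[ m ≤ n ] ∑[ i ≤ n ] (tail f (toℕ m) * ((g ^ˢ toℕ m) (toℕ i) * tail g (n ∸ toℕ i)))
    ≡⟨ sum-cong-≗ {suc n} (λ m → collect (toℕ m)) ⟩
  ∑[ m ≤ n ] (tail f (toℕ m) * (g ^ˢ suc (toℕ m)) (suc n))
    ≡⟨ ℚ.+-identityˡ _ ⟨
  0ℚ + ∑[ m ≤ n ] (tail f (toℕ m) * (g ^ˢ suc (toℕ m)) (suc n))
    -- The restored term m = 0 is `f 0` times coefficient n+1 of the series 1, hence zero.
    ≡⟨ cong (_+ ∑[ m ≤ n ] (tail f (toℕ m) * (g ^ˢ suc (toℕ m)) (suc n))) (ℚ.*-zeroʳ (f 0)) ⟨
  tail (f ⟨ g ⟩) n
    ∎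
  where
  expand : ∀ (i : Fin (suc n)) → (tail f ⟨ g ⟩) (toℕ i) * tail g (n ∸ toℕ i)
    ≡ ∑[ m ≤ n ] (tail f (toℕ m) * ((g ^ˢ toℕ m) (toℕ i) * tail g (n ∸ toℕ i)))
  expand i = begin
    (tail f ⟨ g ⟩) (toℕ i) * y
      ≡⟨ cong (_* y) (⟨⟩-truncate (tail f) {g} g₀≡0 (toℕ≤pred[n] i)) ⟩
    ∑[ m ≤ n ] (tail f (toℕ m) * (g ^ˢ toℕ m) (toℕ i)) * y
      ≡⟨ *-distribʳ-sum {suc n} y (λ m → tail f (toℕ m) * (g ^ˢ toℕ m) (toℕ i)) ⟩
    ∑[ m ≤ n ] (tail f (toℕ m) * (g ^ˢ toℕ m) (toℕ i) * y)
      ≡⟨ sum-cong-≗ {suc n} (λ m → ℚ.*-assoc (tail f (toℕ m)) ((g ^ˢ toℕ m) (toℕ i)) y) ⟩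
    ∑[ m ≤ n ] (tail f (toℕ m) * ((g ^ˢ toℕ m) (toℕ i) * y))
      ∎
    where y = tail g (n ∸ toℕ i)
  collect : ∀ m → ∑[ i ≤ n ] (tail f m * ((g ^ˢ m) (toℕ i) * tail g (n ∸ toℕ i)))
    ≡ tail f m * (g ^ˢ suc m) (suc n)
  collect m = begin
    ∑[ i ≤ n ] (tail f m * ((g ^ˢ m) (toℕ i) * tail g (n ∸ toℕ i)))
      ≡⟨ *-distribˡ-sum {suc n} (tail f m) (λ i → (g ^ˢ m) (toℕ i) * tail g (n ∸ toℕ i)) ⟨
    tail f m * ((g ^ˢ m) ⊗ tail g) n
      ≡⟨ cong (tail f m *_) (⊗-tail (g ^ˢ m) g g₀≡0 n) ⟨
    tail f m * ((g ^ˢ m) ⊗ g) (suc n)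
      ≡⟨ cong (tail f m *_) (⊗-comm (g ^ˢ m) g (suc n)) ⟩
    tail f m * (g ^ˢ suc m) (suc n)
      ∎

-- Quotients and the poly-Bernoulli generating function.

-- Follows the long division: constant terms force h₀ = f₀ / g₀, and then `tail h` solves the
-- division problem for the remainder.
divide-unique : ∀ f g h .{{_ : NonZero (g 0)}} → h ⊗ g ≗ f → divide f g ≗ h
divide-unique f g h h⊗g≗f = go
  where
  head≡ : f 0 ÷ g 0 ≡ h 0
  head≡ = begin
    f 0 * ℚ.1/ g 0                 ≡⟨ cong (_* ℚ.1/ g 0) (h⊗g≗f 0) ⟨
    (h 0 * g 0 + 0ℚ) * ℚ.1/ g 0    ≡⟨ cong (_* ℚ.1/ g 0) (ℚ.+-identityʳ (h 0 * g 0)) ⟩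
    h 0 * g 0 * ℚ.1/ g 0           ≡⟨ ℚ.*-assoc (h 0) (g 0) (ℚ.1/ g 0) ⟩
    h 0 * (g 0 * ℚ.1/ g 0)         ≡⟨ cong (h 0 *_) (ℚ.*-inverseʳ (g 0)) ⟩
    h 0 * 1ℚ                     ≡⟨ ℚ.*-identityʳ (h 0) ⟩
    h 0                          ∎
  tail≡ : ∀ n → (tail h ⊗ g) n ≡ tail f n - (f 0 ÷ g 0) * tail g n
  tail≡ n = begin
    (tail h ⊗ g) n
      ≡⟨ solve 2 (λ a b → b := a :+ b :- a) refl (h 0 * tail g n) ((tail h ⊗ g) n) ⟩
    (h ⊗ g) (suc n) - h 0 * tail g n
      ≡⟨ cong₂ (λ a b → a - b * tail g n) (h⊗g≗f (suc n)) (sym head≡) ⟩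
    tail f n - (f 0 ÷ g 0) * tail g n
      ∎
    where open ℚ-Solver.+-*-Solver
  go : divide f g ≗ h
  go zero    = head≡
  go (suc n) = divide-unique _ g (tail h) tail≡ n

-- `tail (polylog p)` is Li_p(x)/x, and `tail-⟨⟩` shows that its composite with `1-exp⁻` solves the
-- division problem defining the generating function.
polyBernoulliGF-⟨⟩ : ∀ p → polyBernoulliGF p ≗ tail (polylog p) ⟨ 1-exp⁻ ⟩
polyBernoulliGF-⟨⟩ p = divide-unique _ (tail 1-exp⁻) (tail (polylog p) ⟨ 1-exp⁻ ⟩)
  (tail-⟨⟩ (polylog p) {1-exp⁻} refl)

-- Derivatives of the powers of 1 - exp (- t)

-- Both sides equal `exp⁻`: differentiation turns 1/(n+1)! into 1/n!, and the two minus signs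
-- cancel.
deriv-1-exp⁻ : ∀ n → deriv 1-exp⁻ n ≡ const 1ℚ n - 1-exp⁻ n
deriv-1-exp⁻ n = begin
  toℚ (suc n) * (0ℚ - (- 1ℚ * a) * 1/ suc n !)
    ≡⟨ solve 3 (λ s a b → s :* (con 0ℚ :- (:- con 1ℚ :* a) :* b) := a :* (s :* b)) refl
         (toℚ (suc n)) a (1/ suc n !) ⟩
  a * (toℚ (suc n) * 1/ suc n !)
    ≡⟨ cong (a *_) (toℚ-suc-1/! n) ⟩
  a * 1/ n !
    ≡⟨ solve 2 (λ c e → e := c :- (c :- e)) refl (const 1ℚ n) (exp⁻ n) ⟩
  const 1ℚ n - 1-exp⁻ n
    ∎
  where
  open ℚ-Solver.+-*-Solver
  a = (- 1ℚ) ℚ^.^ n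

-- The chain rule (m+1) u^m u′ with u′ = 1 - u, obtained from the Leibniz rule for u · u^m by
-- induction on m.
deriv-1-exp⁻-^ˢ : ∀ m n →
  deriv (1-exp⁻ ^ˢ suc m) n ≡ toℚ (suc m) * ((1-exp⁻ ^ˢ m) n - (1-exp⁻ ^ˢ suc m) n)
deriv-1-exp⁻-^ˢ m n = begin
  deriv (u ⊗ (u ^ˢ m)) n
    ≡⟨ deriv-⊗ u (u ^ˢ m) n ⟩
  (deriv u ⊗ (u ^ˢ m)) n + (u ⊗ deriv (u ^ˢ m)) n
    ≡⟨ cong₂ _+_ first (second m) ⟩
  (u ^ˢ m) n - (u ^ˢ suc m) n + toℚ m * ((u ^ˢ m) n - (u ^ˢ suc m) n)
    ≡⟨ solve 2 (λ x k → x :+ k :* x := (con 1ℚ :+ k) :* x) refl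
         ((u ^ˢ m) n - (u ^ˢ suc m) n) (toℚ m) ⟩
  (1ℚ + toℚ m) * ((u ^ˢ m) n - (u ^ˢ suc m) n)
    ≡⟨ cong (_* ((u ^ˢ m) n - (u ^ˢ suc m) n)) (toℚ-homo-+ 1 m) ⟨
  toℚ (suc m) * ((u ^ˢ m) n - (u ^ˢ suc m) n)
    ∎
  where
  open ℚ-Solver.+-*-Solver
  u = 1-exp⁻
  first : (deriv u ⊗ (u ^ˢ m)) n ≡ (u ^ˢ m) n - (u ^ˢ suc m) n
  first = begin
    (deriv u ⊗ (u ^ˢ m)) n                          ≡⟨ ⊗-comm (deriv u) (u ^ˢ m) n ⟩
    ((u ^ˢ m) ⊗ deriv u) n                          ≡⟨ ⊗-congʳ (u ^ˢ m) deriv-1-exp⁻ n ⟩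
    ((u ^ˢ m) ⊗ (λ k → const 1ℚ k - u k)) n         ≡⟨ ⊗-distribˡ-- (u ^ˢ m) (const 1ℚ) u n ⟩
    ((u ^ˢ m) ⊗ const 1ℚ) n - ((u ^ˢ m) ⊗ u) n
      ≡⟨ cong₂ _-_ (trans (⊗-comm (u ^ˢ m) (const 1ℚ) n) (⊗-identityˡ (u ^ˢ m) n))
                   (⊗-comm (u ^ˢ m) u n) ⟩
    (u ^ˢ m) n - (u ^ˢ suc m) n                     ∎
  -- The induction hypothesis covers positive exponents only, so the constant u^0 is treated apart.
  second : ∀ m → (u ⊗ deriv (u ^ˢ m)) n ≡ toℚ m * ((u ^ˢ m) n - (u ^ˢ suc m) n)
  second zero = begin
    (u ⊗ deriv (const 1ℚ)) n
      ≡⟨ sum-zero {suc n} _ (λ i → trans (cong (u (toℕ i) *_) (deriv-const 1ℚ (n ∸ toℕ i))) (ℚ.*-zeroʳ (u (toℕ i)))) ⟩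
    0ℚ
      ≡⟨ ℚ.*-zeroˡ (const 1ℚ n - (u ^ˢ 1) n) ⟨
    0ℚ * (const 1ℚ n - (u ^ˢ 1) n)
      ∎
  second (suc m) = begin
    (u ⊗ deriv (u ^ˢ suc m)) n
      ≡⟨ ⊗-congʳ u (deriv-1-exp⁻-^ˢ m) n ⟩
    (u ⊗ (λ k → toℚ (suc m) * ((u ^ˢ m) k - (u ^ˢ suc m) k))) n
      ≡⟨ ⊗-*-scalar (toℚ (suc m)) u (λ k → (u ^ˢ m) k - (u ^ˢ suc m) k) n ⟩
    toℚ (suc m) * (u ⊗ (λ k → (u ^ˢ m) k - (u ^ˢ suc m) k)) n
      ≡⟨ cong (toℚ (suc m) *_) (⊗-distribˡ-- u (u ^ˢ m) (u ^ˢ suc m) n) ⟩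
    toℚ (suc m) * ((u ^ˢ suc m) n - (u ^ˢ suc (suc m)) n)
      ∎

-- The Stirling transform

-- The functional Lₙ. The factor k! converts ordinary into exponential coefficients.
stirlingSum : ℕ → Series → ℚ
stirlingSum n f = ∑[ k ≤ n ] (toℚ (stirling₁ (suc n) (suc (toℕ k))) * (toℚ (toℕ k !) * f (toℕ k)))

stirlingSum-cong : ∀ n {f g} → (∀ k → k ≤ n → f k ≡ g k) → stirlingSum n f ≡ stirlingSum n g
stirlingSum-cong n f≡g = sum-cong-≗ {suc n} λ k →
  cong (λ x → toℚ (stirling₁ (suc n) (suc (toℕ k))) * (toℚ (toℕ k !) * x))
       (f≡g (toℕ k) (toℕ≤pred[n] k))

stirlingSum-*-scalar : ∀ n a f → stirlingSum n (λ k → a * f k) ≡ a * stirlingSum n f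
stirlingSum-*-scalar n a f = trans
  (sum-cong-≗ {suc n} λ k → solve 4 (λ s t a x → s :* (t :* (a :* x)) := a :* (s :* (t :* x))) refl
     (toℚ (stirling₁ (suc n) (suc (toℕ k)))) (toℚ (toℕ k !)) a (f (toℕ k)))
  (sym (*-distribˡ-sum {suc n} a λ k → toℚ (stirling₁ (suc n) (suc (toℕ k))) * (toℚ (toℕ k !) * f (toℕ k))))
  where open ℚ-Solver.+-*-Solver

stirlingSum-+ : ∀ n f g → stirlingSum n (λ k → f k + g k) ≡ stirlingSum n f + stirlingSum n g
stirlingSum-+ n f g = trans
  (sum-cong-≗ {suc n} λ k → solve 4 (λ s t x y → s :* (t :* (x :+ y)) := s :* (t :* x) :+ s :* (t :* y)) refl
     (toℚ (stirling₁ (suc n) (suc (toℕ k)))) (toℚ (toℕ k !)) (f (toℕ k)) (g (toℕ k)))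
  (∑-distrib-+ {suc n} (λ k → toℚ (stirling₁ (suc n) (suc (toℕ k))) * (toℚ (toℕ k !) * f (toℕ k)))
              (λ k → toℚ (stirling₁ (suc n) (suc (toℕ k))) * (toℚ (toℕ k !) * g (toℕ k))))
  where open ℚ-Solver.+-*-Solver

stirlingSum-zero : ∀ n → stirlingSum n (λ _ → 0ℚ) ≡ 0ℚ
stirlingSum-zero n = sum-zero {suc n} _ λ k → trans
  (cong (toℚ (stirling₁ (suc n) (suc (toℕ k))) *_) (ℚ.*-zeroʳ (toℚ (toℕ k !))))
  (ℚ.*-zeroʳ (toℚ (stirling₁ (suc n) (suc (toℕ k)))))

stirlingSum-∑ : ∀ n {l} (f : Fin l → Series) →
  stirlingSum n (λ k → ∑[ m < l ] f m k) ≡ ∑[ m < l ] stirlingSum n (f m)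
stirlingSum-∑ n {zero}  f = stirlingSum-zero n
stirlingSum-∑ n {suc l} f = trans
  (stirlingSum-+ n (f Fin.zero) (λ k → ∑[ m < l ] f (Fin.suc m) k))
  (cong (stirlingSum n (f Fin.zero) +_) (stirlingSum-∑ n (f ∘ Fin.suc)))

-- In [n+2, k+1] = [n+1, k] + (n+1) [n+1, k+1] the first part, shifted by one in k, meets (k+1)!
-- f(k+1) = k! f′(k).
stirlingSum-suc : ∀ n f →
  stirlingSum (suc n) f ≡ stirlingSum n (deriv f) + toℚ (suc n) * stirlingSum n f
stirlingSum-suc n f = begin
  stirlingSum (suc n) f
    ≡⟨ sum-cong-≗ {suc (suc n)} (λ k → recurrence (toℕ k)) ⟩
  ∑[ k ≤ suc n ] (s (toℕ k) * t (toℕ k) + toℚ (suc n) * (s (suc (toℕ k)) * t (toℕ k)))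
    ≡⟨ ∑-distrib-+ {suc (suc n)} (λ k → s (toℕ k) * t (toℕ k)) (λ k → toℚ (suc n) * (s (suc (toℕ k)) * t (toℕ k))) ⟩
  ∑[ k ≤ suc n ] (s (toℕ k) * t (toℕ k)) + ∑[ k ≤ suc n ] (toℚ (suc n) * (s (suc (toℕ k)) * t (toℕ k)))
    ≡⟨ cong₂ _+_ first second ⟩
  stirlingSum n (deriv f) + toℚ (suc n) * stirlingSum n f
    ∎
  where
  open ℚ-Solver.+-*-Solver
  s t : ℕ → ℚ
  s k = toℚ (stirling₁ (suc n) k)
  t k = toℚ (k !) * f k
  recurrence : ∀ k → toℚ (stirling₁ (suc (suc n)) (suc k)) * t k
                       ≡ s k * t k + toℚ (suc n) * (s (suc k) * t k)
  recurrence k = begin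
    toℚ (stirling₁ (suc (suc n)) (suc k)) * t k
      ≡⟨ cong (λ x → toℚ x * t k) (stirling₁-suc-suc (suc n) k) ⟩
    toℚ (stirling₁ (suc n) k ℕ.+ suc n ℕ.* stirling₁ (suc n) (suc k)) * t k
      ≡⟨ cong (_* t k) (toℚ-homo-+ (stirling₁ (suc n) k) _) ⟩
    (s k + toℚ (suc n ℕ.* stirling₁ (suc n) (suc k))) * t k
      ≡⟨ cong (λ x → (s k + x) * t k) (toℚ-homo-* (suc n) (stirling₁ (suc n) (suc k))) ⟩
    (s k + toℚ (suc n) * s (suc k)) * t k
      ≡⟨ solve 4 (λ a b c t → (a :+ b :* c) :* t := a :* t :+ b :* (c :* t)) refl
           (s k) (toℚ (suc n)) (s (suc k)) (t k) ⟩
    s k * t k + toℚ (suc n) * (s (suc k) * t k)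
      ∎
  t-suc : ∀ k → t (suc k) ≡ toℚ (k !) * deriv f k
  t-suc k = trans (cong (_* f (suc k)) (toℚ-homo-* (suc k) (k !)))
    (solve 3 (λ a b x → a :* b :* x := b :* (a :* x)) refl (toℚ (suc k)) (toℚ (k !)) (f (suc k)))
  first : ∑[ k ≤ suc n ] (s (toℕ k) * t (toℕ k)) ≡ stirlingSum n (deriv f)
  first = begin
    s 0 * t 0 + ∑[ k ≤ n ] (s (suc (toℕ k)) * t (suc (toℕ k)))
      -- [n+1, 0] computes to 0, since the rising factorial starts with the factor x.
      ≡⟨ cong₂ _+_ (ℚ.*-zeroˡ (t 0))
           (sum-cong-≗ {suc n} λ k → cong (s (suc (toℕ k)) *_) (t-suc (toℕ k))) ⟩
    0ℚ + stirlingSum n (deriv f)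
      ≡⟨ ℚ.+-identityˡ _ ⟩
    stirlingSum n (deriv f)
      ∎
  second : ∑[ k ≤ suc n ] (toℚ (suc n) * (s (suc (toℕ k)) * t (toℕ k))) ≡ toℚ (suc n) * stirlingSum n f
  second = begin
    ∑[ k ≤ suc n ] (toℚ (suc n) * (s (suc (toℕ k)) * t (toℕ k)))
      ≡⟨ *-distribˡ-sum {suc (suc n)} (toℚ (suc n)) (λ k → s (suc (toℕ k)) * t (toℕ k)) ⟨
    toℚ (suc n) * ∑[ k ≤ suc n ] (s (suc (toℕ k)) * t (toℕ k))
      -- The top term k = n+1 drops out because [n+1, n+2] = 0.
      ≡⟨ cong (toℚ (suc n) *_) (sum-extend (λ k → s (suc k) * t k) (ℕ.n≤1+n (suc n)) beyond) ⟨
    toℚ (suc n) * stirlingSum n f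
      ∎
    where
    beyond : ∀ k → suc n ≤ k → s (suc k) * t k ≡ 0ℚ
    beyond k n<k = trans (cong (λ x → toℚ x * t k) (stirling₁-< (s≤s n<k))) (ℚ.*-zeroˡ (t k))

stirlingSum-1-exp⁻-^ˢ : ∀ {m n} → m ≤ n → stirlingSum n (1-exp⁻ ^ˢ m) ≡ toℚ (n !)
stirlingSum-1-exp⁻-^ˢ {zero} {zero} _ = refl
stirlingSum-1-exp⁻-^ˢ {zero} {suc n} _ = begin
  stirlingSum (suc n) (const 1ℚ)
    ≡⟨ stirlingSum-suc n (const 1ℚ) ⟩
  stirlingSum n (deriv (const 1ℚ)) + toℚ (suc n) * stirlingSum n (const 1ℚ)
    ≡⟨ cong₂ (λ a b → a + toℚ (suc n) * b) deriv≡0 (stirlingSum-1-exp⁻-^ˢ {n = n} z≤n) ⟩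
  0ℚ + toℚ (suc n) * toℚ (n !)
    ≡⟨ ℚ.+-identityˡ _ ⟩
  toℚ (suc n) * toℚ (n !)
    ≡⟨ toℚ-homo-* (suc n) (n !) ⟨
  toℚ (suc n !)
    ∎
  where
  deriv≡0 : stirlingSum n (deriv (const 1ℚ)) ≡ 0ℚ
  deriv≡0 = trans
    (stirlingSum-cong n λ k _ → deriv-const 1ℚ k)
    (stirlingSum-zero n)
stirlingSum-1-exp⁻-^ˢ {suc m} {suc n} (s≤s m≤n) = begin
  stirlingSum (suc n) (u ^ˢ suc m)
    ≡⟨ stirlingSum-suc n (u ^ˢ suc m) ⟩
  stirlingSum n (deriv (u ^ˢ suc m)) + N * b
    ≡⟨ cong (_+ N * b) deriv≡ ⟩
  M * (a + - 1ℚ * b) + N * b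
    -- Regrouped around N · a: the induction hypothesis always gives a, but gives b only for m < n.
    ≡⟨ solve 4 (λ M N a b → M :* (a :+ (:- con 1ℚ) :* b) :+ N :* b
                          := N :* a :+ (N :- M) :* (b :- a)) refl M N a b ⟩
  N * a + (N - M) * (b - a)
    ≡⟨ cong (N * a +_) (vanish (ℕ.m≤n⇒m<n∨m≡n m≤n)) ⟩
  N * a + 0ℚ
    ≡⟨ ℚ.+-identityʳ _ ⟩
  N * a
    ≡⟨ cong (N *_) a≡ ⟩
  N * toℚ (n !)
    ≡⟨ toℚ-homo-* (suc n) (n !) ⟨
  toℚ (suc n !)
    ∎
  where
  open ℚ-Solver.+-*-Solver
  u = 1-exp⁻
  M = toℚ (suc m)
  N = toℚ (suc n)
  a = stirlingSum n (u ^ˢ m)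
  b = stirlingSum n (u ^ˢ suc m)
  a≡ : a ≡ toℚ (n !)
  a≡ = stirlingSum-1-exp⁻-^ˢ m≤n
  deriv≡ : stirlingSum n (deriv (u ^ˢ suc m)) ≡ M * (a + - 1ℚ * b)
  deriv≡ = begin
    stirlingSum n (deriv (u ^ˢ suc m))
      ≡⟨ stirlingSum-cong n (λ k _ → trans (deriv-1-exp⁻-^ˢ m k)
           (cong (M *_) (solve 2 (λ x y → x :- y := x :+ (:- con 1ℚ) :* y) refl ((u ^ˢ m) k) ((u ^ˢ suc m) k)))) ⟩
    stirlingSum n (λ k → M * ((u ^ˢ m) k + - 1ℚ * (u ^ˢ suc m) k))
      ≡⟨ stirlingSum-*-scalar n M (λ k → (u ^ˢ m) k + - 1ℚ * (u ^ˢ suc m) k) ⟩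
    M * stirlingSum n (λ k → (u ^ˢ m) k + - 1ℚ * (u ^ˢ suc m) k)
      ≡⟨ cong (M *_) (stirlingSum-+ n (u ^ˢ m) (λ k → - 1ℚ * (u ^ˢ suc m) k)) ⟩
    M * (a + stirlingSum n (λ k → - 1ℚ * (u ^ˢ suc m) k))
      ≡⟨ cong (λ x → M * (a + x)) (stirlingSum-*-scalar n (- 1ℚ) (u ^ˢ suc m)) ⟩
    M * (a + - 1ℚ * b)
      ∎
  -- For m = n the value of b is not available, but its coefficient N - M is 0.
  vanish : m < n ⊎ m ≡ n → (N - M) * (b - a) ≡ 0ℚ
  vanish (inj₁ m<n) = begin
    (N - M) * (b - a)                  ≡⟨ cong₂ (λ x y → (N - M) * (x - y)) (stirlingSum-1-exp⁻-^ˢ m<n) a≡ ⟩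
    (N - M) * (toℚ (n !) - toℚ (n !))  ≡⟨ cong ((N - M) *_) (ℚ.+-inverseʳ (toℚ (n !))) ⟩
    (N - M) * 0ℚ                       ≡⟨ ℚ.*-zeroʳ (N - M) ⟩
    0ℚ                                 ∎
  vanish (inj₂ refl) = trans (cong (_* (b - a)) (ℚ.+-inverseʳ N)) (ℚ.*-zeroˡ (b - a))

-- The transform of a composite, and the identity.

-- Up to degree n, all that Lₙ sees, the composite is a finite combination of the powers u^m with m
-- ≤ n, and each power contributes n!.
stirlingSum-⟨1-exp⁻⟩ : ∀ f n → stirlingSum n (f ⟨ 1-exp⁻ ⟩) ≡ toℚ (n !) * ∑[ m ≤ n ] f (toℕ m)
stirlingSum-⟨1-exp⁻⟩ f n = begin
  stirlingSum n (f ⟨ 1-exp⁻ ⟩)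
    ≡⟨ stirlingSum-cong n (λ k k≤n → ⟨⟩-truncate f {1-exp⁻} refl k≤n) ⟩
  stirlingSum n (λ k → ∑[ m ≤ n ] (f (toℕ m) * (1-exp⁻ ^ˢ toℕ m) k))
    ≡⟨ stirlingSum-∑ n {suc n} (λ m k → f (toℕ m) * (1-exp⁻ ^ˢ toℕ m) k) ⟩
  ∑[ m ≤ n ] stirlingSum n (λ k → f (toℕ m) * (1-exp⁻ ^ˢ toℕ m) k)
    ≡⟨ sum-cong-≗ {suc n} (λ m → begin
         stirlingSum n (λ k → f (toℕ m) * (1-exp⁻ ^ˢ toℕ m) k)
           ≡⟨ stirlingSum-*-scalar n (f (toℕ m)) (1-exp⁻ ^ˢ toℕ m) ⟩
         f (toℕ m) * stirlingSum n (1-exp⁻ ^ˢ toℕ m)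
           ≡⟨ cong (f (toℕ m) *_) (stirlingSum-1-exp⁻-^ˢ (toℕ≤pred[n] m)) ⟩
         f (toℕ m) * toℚ (n !)
           ≡⟨ ℚ.*-comm (f (toℕ m)) (toℚ (n !)) ⟩
         toℚ (n !) * f (toℕ m)
           ∎) ⟩
  ∑[ m ≤ n ] (toℚ (n !) * f (toℕ m))
    ≡⟨ *-distribˡ-sum {suc n} (toℚ (n !)) (f ∘ toℕ) ⟨
  toℚ (n !) * ∑[ m ≤ n ] f (toℕ m)
    ∎

corollary2 : (p : ℤ) (n : ℕ) →
    ∑[ k ≤ n ] (toℚ (stirling₁ (suc n) (suc (toℕ k))) * polyBernoulli p (toℕ k))
    ≡ toℚ (n !) * harmonic p (suc n)
corollary2 p n = trans
  -- `polyBernoulli` unfolds to k! times a coefficient of the generating function, so the left side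
  -- is already a `stirlingSum`.
  (stirlingSum-cong n (λ k _ → polyBernoulliGF-⟨⟩ p k))
  -- Coefficient m of `tail (polylog p)` is 1/(m+1)^p, so the sum over m ≤ n unfolds to
  -- `harmonic p (suc n)`.
  (stirlingSum-⟨1-exp⁻⟩ (tail (polylog p)) n)
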